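{- For every integer $k\ge 4$ there exists $c>0$ such that for all sufficiently large $t$, $$r_k(t;3,3)\ge T_{k-1}(t^c).$$
   Context: $K_n^{(k)}$ is the complete $k$-uniform hypergraph on $n$ vertices. For integers $q\ge p$, $r_k(t;q,p)$ is the smallest integer $n$ such that in every colouring of the edges of $K_n^{(k)}$ with $q$ colours there is a set of $t$ vertices such that the $k$-edges contained in it receive fewer than $p$ distinct colours in total. The tower function is defined by $T_1(x)=x$ and $T_{i+1}(x)=2^{T_i(x)}$. -}

module Defs where

open import Algebra.Definitions.RawSemiring using ()
open import Data.Fin as Fin using (Fin)
open import Data.Fin.Subset using (Subset; _⊆_; ∣_∣)
open import Data.Fin.Subset.Properties using (anySubset?; _⊆?_)
open import Data.Integer as ℤ using (ℤ; +_)
import Data.Integer.Properties as ℤₚ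
open import Data.Nat as ℕ using (ℕ; zero; suc)
import Data.Nat.Properties as ℕₚ
open import Data.Product using (Σ; ∃; _×_; _,_; proj₁)
open import Data.Rational as ℚ using (ℚ; 0ℚ; ↥_; ↧ₙ_)
open import Data.Rational.Literals using (fromℤ)
import Data.Rational.Properties as ℚₚ
open import Data.Vec using (tabulate)
open import Relation.Binary.PropositionalEquality
open import Relation.Nullary using (Dec; yes; no; does; contradiction)
open import Relation.Nullary.Decidable using (_×-dec_)

open Algebra.Definitions.RawSemiring ℚ.+-*-rawSemiring
  using () renaming (_^_ to _^ℚ_)

------------------------------------------------------------------------
-- Generalised Ramsey numbers

-- The edges of the complete k-uniform hypergraph with vertex set Fin n.
Edge : ℕ → ℕ → Set
Edge k n = Σ (Subset n) λ e → ∣ e ∣ ≡ k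

Colouring : ℕ → ℕ → ℕ → Set
Colouring k n q = Edge k n → Fin q

module _ {k n q : ℕ} (χ : Colouring k n q) (S : Subset n) where

  ReceivedInside : Fin q → Set
  ReceivedInside i = ∃ λ e → e ⊆ S × Σ (∣ e ∣ ≡ k) λ ∣e∣≡k → χ (e , ∣e∣≡k) ≡ i

  receivedInside? : ∀ i → Dec (ReceivedInside i)
  receivedInside? i = anySubset? λ e → (e ⊆? S) ×-dec hasColour? e
    where
    hasColour? : ∀ e → Dec (Σ (∣ e ∣ ≡ k) λ ∣e∣≡k → χ (e , ∣e∣≡k) ≡ i)
    hasColour? e with ∣ e ∣ ℕ.≟ k
    ... | no ∣e∣≢k = no λ where (∣e∣≡k , _) → ∣e∣≢k ∣e∣≡k
    ... | yes ∣e∣≡k with χ (e , ∣e∣≡k) Fin.≟ i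
    ...   | yes χe≡i = yes (∣e∣≡k , χe≡i)
    ...   | no  χe≢i = no λ where
      (h , χe≡i) → χe≢i (trans (cong (λ z → χ (e , z)) (ℕₚ.≡-irrelevant ∣e∣≡k h)) χe≡i)

  coloursInside : Subset q
  coloursInside = tabulate λ i → does (receivedInside? i)

Forces : (k t q p n : ℕ) → Set
Forces k t q p n = (χ : Colouring k n q) →
  Σ (Subset n) λ S → ∣ S ∣ ≡ t × ∣ coloursInside χ S ∣ ℕ.< p

-- "r = r_k(t; q, p)".  A relation rather than a function: that such an r
-- exists is Ramsey's theorem (for p ≥ 2), which is not proved here.
IsRamseyNumber : (k t q p r : ℕ) → Set
IsRamseyNumber k t q p r =
  Forces k t q p r × (∀ n → Forces k t q p n → r ℕ.≤ n)

------------------------------------------------------------------------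
-- Nonnegative reals, real exponents and the tower function

-- A nonnegative real, given as the supremum of an inhabited bounded set of
-- nonnegative rationals; different sets may represent the same real.
record ℝ≥0 : Set₁ where
  field
    _∋_       : ℚ → Set
    nonneg    : ∀ {r} → _∋_ r → 0ℚ ℚ.≤ r
    inhabited : ∃ _∋_
    bounded   : ∃ λ (B : ℕ) → ∀ {r} → _∋_ r → r ℚ.≤ fromℤ (+ B)

open ℝ≥0 public using (_∋_)

Positive : ℝ≥0 → Set
Positive x = ∃ λ r → x ∋ r × 0ℚ ℚ.< r

infix 4 _≤ᴺ_

_≤ᴺ_ : ℝ≥0 → ℕ → Set
x ≤ᴺ n = ∀ r → x ∋ r → r ℚ.≤ fromℤ (+ n)

-- For r, s ≥ 0 and s = u/v in lowest terms, r ≤ b^(u/v) means r^v ≤ b^u.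
RootBound : ℕ → ℚ → ℚ → Set
RootBound b s r = r ^ℚ (↧ₙ s) ℚ.≤ fromℤ (+ (b ℕ.^ ℤ.∣ ↥ s ∣))

fromℤ-mono : ∀ {m n} → m ℕ.≤ n → fromℤ (+ m) ℚ.≤ fromℤ (+ n)
fromℤ-mono {m} {n} m≤n = ℚ.*≤* (ℤₚ.*-monoʳ-≤-nonNeg (+ 1) (ℤ.+≤+ m≤n))

fromℤ-pos : ∀ {m} → 0 ℕ.< m → ℚ.Positive (fromℤ (+ m))
fromℤ-pos {suc m} _ = _

fromℤ-* : ∀ m n → fromℤ (+ m) ℚ.* fromℤ (+ n) ≡ fromℤ (+ (m ℕ.* n))
fromℤ-* m n = trans (cong (ℚ._/ 1) (sym (ℤₚ.pos-* m n)))
                    (ℚₚ.↥p/↧p≡p (fromℤ (+ (m ℕ.* n))))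

fromℤ-^ : ∀ m v → fromℤ (+ m) ^ℚ v ≡ fromℤ (+ (m ℕ.^ v))
fromℤ-^ m zero    = refl
fromℤ-^ m (suc v) = trans (cong (fromℤ (+ m) ℚ.*_) (fromℤ-^ m v)) (fromℤ-* m (m ℕ.^ v))

0^suc : ∀ v → 0ℚ ^ℚ suc v ≡ 0ℚ
0^suc v = ℚₚ.*-zeroˡ (0ℚ ^ℚ v)

^ℚ-mono-< : ∀ {c a} .{{_ : ℚ.Positive c}} → c ℚ.< a → ∀ v → c ^ℚ suc v ℚ.< a ^ℚ suc v
^ℚ-mono-< {c} {a} c<a zero =
  subst₂ ℚ._<_ (sym (ℚₚ.*-identityʳ c)) (sym (ℚₚ.*-identityʳ a)) c<a
^ℚ-mono-< {c} {a} c<a (suc v) = ℚₚ.<-trans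
  (ℚₚ.*-monoʳ-<-pos c ih)
  (ℚₚ.*-monoˡ-<-pos (a ^ℚ suc v) {{pos-a^}} c<a)
  where
  ih = ^ℚ-mono-< c<a v
  pos-c^ : ∀ w → ℚ.Positive (c ^ℚ w)
  pos-c^ zero    = _
  pos-c^ (suc w) = ℚₚ.pos*pos⇒pos c (c ^ℚ w) {{pos-c^ w}}
  pos-a^ : ℚ.Positive (a ^ℚ suc v)
  pos-a^ = ℚ.positive (ℚₚ.<-trans (ℚₚ.positive⁻¹ (c ^ℚ suc v) {{pos-c^ (suc v)}}) ih)

-- b ^ᴿ x is b^x for b ≥ 1: then b^x is the supremum of b^s over x ∋ s.
infixr 8 _^ᴿ_

_^ᴿ_ : ℕ → ℝ≥0 → ℝ≥0
b ^ᴿ x = record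
  { _∋_       = λ r → 0ℚ ℚ.≤ r × ∃ λ s → x ∋ s × RootBound b s r
  ; nonneg    = proj₁
  ; inhabited = let s , x∋s = ℝ≥0.inhabited x in
      0ℚ , ℚₚ.≤-refl , s , x∋s ,
      subst (ℚ._≤ fromℤ (+ (b ℕ.^ ℤ.∣ ↥ s ∣))) (sym (0^suc (ℚ.denominator-1 s)))
        (fromℤ-mono {0} ℕ.z≤n)
  ; bounded   = let B , x≤B = ℝ≥0.bounded x in
      suc b ℕ.^ B ,
      λ (_ , s , x∋s , r≤) → bound B _ s (ℝ≥0.nonneg x x∋s) (x≤B x∋s) r≤
  }
  where
  bound : ∀ B r s → 0ℚ ℚ.≤ s → s ℚ.≤ fromℤ (+ B) → RootBound b s r →
          r ℚ.≤ fromℤ (+ (suc b ℕ.^ B))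
  bound B r s@(ℚ.mkℚ (+ u) v-1 _) _ (ℚ.*≤* s≤B) r≤ with r ℚ.≤? fromℤ (+ (suc b ℕ.^ B))
  ... | yes r≤C = r≤C
  ... | no  r≰C = contradiction
          (ℚₚ.<-≤-trans (^ℚ-mono-< {{posC}} (ℚₚ.≰⇒> r≰C) v-1) (ℚₚ.≤-trans r≤ b^u≤))
          (ℚₚ.<-irrefl refl)
    where
    posC : ℚ.Positive (fromℤ (+ (suc b ℕ.^ B)))
    posC = fromℤ-pos (ℕₚ.m^n>0 (suc b) B)
    u≤ : u ℕ.≤ B ℕ.* suc v-1
    u≤ = ℤₚ.drop‿+≤+ (subst₂ ℤ._≤_ (ℤₚ.*-identityʳ _) (sym (ℤₚ.pos-* B (suc v-1))) s≤B)
    b^u≤ : fromℤ (+ (b ℕ.^ u)) ℚ.≤ fromℤ (+ (suc b ℕ.^ B)) ^ℚ suc v-1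
    b^u≤ = subst (fromℤ (+ (b ℕ.^ u)) ℚ.≤_) (sym (fromℤ-^ (suc b ℕ.^ B) (suc v-1)))
      (fromℤ-mono (ℕₚ.≤-trans (ℕₚ.^-monoˡ-≤ u (ℕₚ.n≤1+n b))
        (ℕₚ.≤-trans (ℕₚ.^-monoʳ-≤ (suc b) u≤)
          (ℕₚ.≤-reflexive (sym (ℕₚ.^-*-assoc (suc b) B (suc v-1)))))))
  bound B r (ℚ.mkℚ ℤ.-[1+ _ ] _ _) (ℚ.*≤* ()) _ _

-- The index starts at 1; T 0 is a junk value.
T : ℕ → ℝ≥0 → ℝ≥0
T zero          x = x
T (suc zero)    x = x
T (suc (suc i)) x = 2 ^ᴿ T (suc i) x

{-# OPTIONS --safe #-}
-- A set of {0,1}-vectors of length n is a binary trie of depth n, and its shape drives both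
-- constructions below.
-- k = 3.  A triple of {0,1}^n splits for the first time into one vector x and a pair that splits
-- later, at level b.  Colour it by the side of x and, if x is on the left, by the bit of x at
-- level b.  If a set misses the colour of one of the two bits, then at every branching node the
-- left and right subtrees branch at disjoint sets of levels; if it misses the third colour, the
-- trie is a comb.  Either way it has at most n + 1 elements.
-- k → k + 1, n → 2^n (stepping up).  If the first split is balanced, the colour is 2; if
-- a single vector splits off on the left (right) and the rest then has two or more vectors on the
-- left (right) of its first split, the colour is 0 (1); all other (k + 1)-sets, in particular the
-- left and right combs, inherit the colour of their set of levels.  A set whose chains of left
-- branches and of right branches are all shorter than t, and which misses one of the three
-- patterns, has fewer than (k + t)(1 + t) elements; and a chain of t levels sees all three
-- colours by induction.
-- The losses are polynomial, so they are absorbed by c = 1/D.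
module Submission where

open import Defs
open import Data.Bool as Bool using (Bool; true; false; if_then_else_; b≤b; f≤t)
open import Data.Fin using (Fin; zero; suc)
open import Data.Fin.Patterns using (0F; 1F; 2F)
open import Data.Fin.Subset using (Subset; inside; outside; Empty; ⊥; ⊤; _∈_; _⊆_; _∪_; _∩_; ∣_∣)
open import Data.Fin.Subset.Properties
open import Data.Integer as ℤ using ()
open import Data.Integer.Properties as ℤ using ()
open import Data.Maybe using (Maybe; just; nothing; fromMaybe)
open import Data.Nat
open import Data.Nat.Coprimality using (1-coprimeTo)
open import Data.Nat.Properties
open import Data.Product using (Σ; ∃; ∃₂; _×_; _,_; proj₁; proj₂)
open import Data.Rational as ℚ using (ℚ; mkℚ; 0ℚ; ↥_; ↧ₙ_)
open import Data.Rational.Literals using (fromℤ)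
open import Data.Rational.Properties as ℚ using ()
open import Data.Sum using (_⊎_; inj₁; inj₂)
open import Data.Vec using ([]; _∷_; _++_; take; drop; here; there)
open import Data.Vec.Properties using (take++drop≡id; lookup⇒[]=; lookup∘tabulate)
open import Function using (_∘′_)
open import Relation.Binary.PropositionalEquality
open import Relation.Nullary using (¬_; does; yes; no; contradiction)
open import Relation.Nullary.Decidable using (dec-true)

-- Sets of {0,1}-vectors as tries, and their first splits.

private
  variable
    n : ℕ
    A : Set

data Trie : ℕ → Set where
  leaf : Bool → Trie 0
  node : Trie n → Trie n → Trie (suc n)

data _⊑_ : Trie n → Trie n → Set where
  leaf : ∀ {b c} → b Bool.≤ c → leaf b ⊑ leaf c
  node : {l r l′ r′ : Trie n} → l ⊑ l′ → r ⊑ r′ → node l r ⊑ node l′ r′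

infix 4 _⊑_

size : Trie n → ℕ
size (leaf true)  = 1
size (leaf false) = 0
size (node l r)   = size l + size r

mirror : Trie n → Trie n
mirror (leaf b)   = leaf b
mirror (node l r) = node (mirror r) (mirror l)

none : ∀ n → Trie n
none zero    = leaf false
none (suc n) = node (none n) (none n)

pad : Bool → Trie n → Trie (suc n)
pad false e = node e (none _)
pad true  e = node (none _) e

child : Bool → Trie n → Trie n → Trie n
child false l r = l
child true  l r = r

branch : ℕ → ℕ → A → A → A → A
branch zero    _       both left right = right
branch (suc _) zero    both left right = left
branch (suc _) (suc _) both left right = both

branch-both : ∀ {x y} → 1 ≤ x → 1 ≤ y → {b l r : A} → branch x y b l r ≡ b
branch-both (s≤s _) (s≤s _) = refl

-- The value of f at the first node with both sides nonempty; a is junk, for at most one leaf.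
onSplit : (∀ {m} → Trie m → Trie m → A) → A → Trie n → A
onSplit f a (leaf _)   = a
onSplit f a (node l r) = branch (size l) (size r) (f l r) (onSplit f a l) (onSplit f a r)

-- In the language of the stepping-up lemma these are the values of δ: the positions at which two
-- members of the set first differ.
levels : Trie n → Subset n
levels (leaf _)   = []
levels (node l r) = branch (size l) (size r) inside outside outside ∷ (levels l ∪ levels r)

1≤-suc : ∀ {m k} → m ≡ suc k → 1 ≤ m
1≤-suc refl = s≤s z≤n

size-mirror : (e : Trie n) → size (mirror e) ≡ size e
size-mirror (leaf _)   = refl
size-mirror (node l r) = trans (cong₂ _+_ (size-mirror r) (size-mirror l)) (+-comm (size r) (size l))

mirror-involutive : (e : Trie n) → mirror (mirror e) ≡ e
mirror-involutive (leaf _)   = refl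
mirror-involutive (node l r) = cong₂ node (mirror-involutive l) (mirror-involutive r)

mirror-⊑ : {e S : Trie n} → e ⊑ S → mirror e ⊑ mirror S
mirror-⊑ (leaf b≤c)   = leaf b≤c
mirror-⊑ (node l⊑ r⊑) = node (mirror-⊑ r⊑) (mirror-⊑ l⊑)

branch-swap : ∀ x y {b a : A} → branch x y b a a ≡ branch y x b a a
branch-swap zero    zero    = refl
branch-swap zero    (suc y) = refl
branch-swap (suc x) zero    = refl
branch-swap (suc x) (suc y) = refl

levels-mirror : (e : Trie n) → levels (mirror e) ≡ levels e
levels-mirror (leaf _)   = refl
levels-mirror (node l r)
  rewrite size-mirror l | size-mirror r | levels-mirror l | levels-mirror r =
  cong₂ _∷_ (branch-swap (size r) (size l)) (∪-comm (levels r) (levels l))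

size-none : ∀ n → size (none n) ≡ 0
size-none zero    = refl
size-none (suc n) rewrite size-none n = refl

levels-none : ∀ n → levels (none n) ≡ ⊥
levels-none zero    = refl
levels-none (suc n) rewrite size-none n | levels-none n = cong (outside ∷_) (∪-identityˡ ⊥)

none-⊑ : (S : Trie n) → none n ⊑ S
none-⊑ (leaf true)  = leaf f≤t
none-⊑ (leaf false) = leaf b≤b
none-⊑ (node l r)   = node (none-⊑ l) (none-⊑ r)

size-pad : ∀ d (e : Trie n) → size (pad d e) ≡ size e
size-pad {n} false e rewrite size-none n = +-identityʳ (size e)
size-pad {n} true  e rewrite size-none n = refl

levels-pad : ∀ d (e : Trie n) → levels (pad d e) ≡ outside ∷ levels e
levels-pad {n} false e rewrite size-none n | levels-none n =
  cong₂ _∷_ (branch-swap (size e) 0) (∪-identityʳ (levels e))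
levels-pad {n} true  e rewrite size-none n | levels-none n =
  cong (outside ∷_) (∪-identityˡ (levels e))

pad-⊑ : ∀ d {e l r : Trie n} → e ⊑ child d l r → pad d e ⊑ node l r
pad-⊑ false e⊑ = node e⊑ (none-⊑ _)
pad-⊑ true  e⊑ = node (none-⊑ _) e⊑

onSplit-pad : ∀ d (f : ∀ {m} → Trie m → Trie m → A) a (e : Trie n) → 1 ≤ size e →
              onSplit f a (pad d e) ≡ onSplit f a e
onSplit-pad {n = n} false f a e 1≤e rewrite size-none n with size e | 1≤e
... | suc _ | _ = refl
onSplit-pad {n = n} true  f a e 1≤e rewrite size-none n = refl

onSplit-mirror : ∀ (f : ∀ {m} → Trie m → Trie m → A) a (e : Trie n) →
  onSplit f a (mirror e) ≡ onSplit (λ l r → f (mirror r) (mirror l)) a e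
onSplit-mirror f a (leaf _) = refl
onSplit-mirror f a (node l r)
  rewrite size-mirror l | size-mirror r | onSplit-mirror f a l | onSplit-mirror f a r
  with size l in l≡ | size r in r≡
-- With both sides empty, `branch` falls through to the right side, so a trie and its mirror image
-- consult different subtries. Both of these give the default `a`.
... | zero  | zero  = trans (onSplit-empty l l≡) (sym (onSplit-empty r r≡))
  where
  onSplit-empty : ∀ {n} (e : Trie n) → size e ≡ 0 → onSplit (λ l r → f (mirror r) (mirror l)) a e ≡ a
  onSplit-empty (leaf _)   _   = refl
  onSplit-empty (node l r) e≡0 rewrite m+n≡0⇒m≡0 (size l) e≡0 = onSplit-empty r (m+n≡0⇒n≡0 (size l) e≡0)
... | zero  | suc _ = refl
... | suc _ | zero  = refl
... | suc _ | suc _ = refl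

-- Subtries of prescribed size and pattern.

-- Greedy choice: `i` is all of `a` unless this leaves less than `q` for `j`, and then `j` is
-- exactly `q`. It serves to cut a branching node down to `k` leaves while keeping `p` on the left
-- and `q` on the right.
+-split : ∀ p q {a b k} → p ≤ a → q ≤ b → p + q ≤ k → k ≤ a + b →
          ∃₂ λ i j → (p ≤ i × i ≤ a) × (q ≤ j × j ≤ b) × i + j ≡ k
+-split p q {a} {b} {k} p≤a q≤b p+q≤k k≤a+b with a + q ≤? k
... | yes a+q≤k = a , k ∸ a , (p≤a , ≤-refl) ,
  (m+n≤o⇒m≤o∸n q (subst (_≤ k) (+-comm a q) a+q≤k) , m≤n+o⇒m∸n≤o k a k≤a+b) ,
  m+[n∸m]≡n (m+n≤o⇒m≤o a a+q≤k)
... | no  a+q≰k = k ∸ q , q ,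
  (m+n≤o⇒m≤o∸n p p+q≤k , m≤n+o⇒m∸n≤o k q (subst (k ≤_) (+-comm a q) (<⇒≤ (≰⇒> a+q≰k)))) ,
  (≤-refl , q≤b) ,
  m∸n+n≡m (m+n≤o⇒n≤o p p+q≤k)

shrink : ∀ j (S : Trie n) → j ≤ size S → ∃ λ e → e ⊑ S × size e ≡ j
shrink {n} zero      S            _        = none n , none-⊑ S , size-none n
shrink (suc zero)    (leaf true)  _        = leaf true , leaf b≤b , refl
shrink (suc (suc _)) (leaf true)  (s≤s ())
shrink j@(suc _)     (node l r)   j≤S
  with i , i′ , (_ , i≤l) , (_ , i′≤r) , i+i′≡j ← +-split 0 0 {size l} {size r} z≤n z≤n z≤n j≤S
  with x , x⊑l , ∣x∣≡i ← shrink i l i≤l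
  with y , y⊑r , ∣y∣≡i′ ← shrink i′ r i′≤r =
  node x y , node x⊑l y⊑r , trans (cong₂ _+_ ∣x∣≡i ∣y∣≡i′) i+i′≡j

-- The size is written `suc k` so that the subtrie found is nonempty, which is what keeps its first
-- split intact under `pad`.
Hits : (∀ {m} → Trie m → Trie m → A) → A → ℕ → A → Trie n → Set
Hits f a k c S = ∃ λ e → e ⊑ S × size e ≡ suc k × onSplit f a e ≡ c

module _ {f : ∀ {m} → Trie m → Trie m → A} {a : A} {k : ℕ} {c : A} where

  hits-child : ∀ d {l r : Trie n} → Hits f a k c (child d l r) → Hits f a k c (node l r)
  hits-child d (e , e⊑ , ∣e∣≡ , fe≡) =
    pad d e , pad-⊑ d e⊑ , trans (size-pad d e) ∣e∣≡ ,
    trans (onSplit-pad d f a e (subst (1 ≤_) (sym ∣e∣≡) (s≤s z≤n))) fe≡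

  hits-node : {x y l r : Trie n} → x ⊑ l → y ⊑ r → 1 ≤ size x → 1 ≤ size y →
              size x + size y ≡ suc k → f x y ≡ c → Hits f a k c (node l r)
  hits-node {x = x} {y} x⊑l y⊑r 1≤x 1≤y x+y≡ fxy≡ = node x y , node x⊑l y⊑r , x+y≡ , value 1≤x 1≤y
    where
    value : 1 ≤ size x → 1 ≤ size y → onSplit f a (node x y) ≡ c
    value 1≤x 1≤y with size x | size y | 1≤x | 1≤y
    ... | suc _ | suc _ | _ | _ = fxy≡

  -- The induction behind all the bounds below. Hits in a child are hits in the node, and at a node
  -- with an empty side the bound passes up by monotonicity, so only branching nodes remain for
  -- `split`.
  hits⊎bounded : (B : ∀ {n} → Trie n → ℕ) → (∀ b → 1 ≤ B (leaf b)) →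
    (∀ d {n} (l r : Trie n) → B (child d l r) ≤ B (node l r)) →
    (∀ {n} (l r : Trie n) → 1 ≤ size l → 1 ≤ size r → size l ≤ B l → size r ≤ B r →
      Hits f a k c (node l r) ⊎ size (node l r) ≤ B (node l r)) →
    (S : Trie n) → Hits f a k c S ⊎ size S ≤ B S
  hits⊎bounded B 1≤B mono split (leaf true)  = inj₂ (1≤B true)
  hits⊎bounded B 1≤B mono split (leaf false) = inj₂ z≤n
  hits⊎bounded B 1≤B mono split (node l r)
    with hits⊎bounded B 1≤B mono split l | hits⊎bounded B 1≤B mono split r
  ... | inj₁ hit | _        = inj₁ (hits-child false hit)
  ... | _        | inj₁ hit = inj₁ (hits-child true hit)
  ... | inj₂ l≤  | inj₂ r≤  with size l ≟ 0 | size r ≟ 0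
  ...   | yes l≡0 | _       rewrite l≡0 = inj₂ (≤-trans r≤ (mono true l r))
  ...   | no _    | yes r≡0 rewrite r≡0 | +-identityʳ (size l) = inj₂ (≤-trans l≤ (mono false l r))
  ...   | no l≢0  | no r≢0  = split l r (n≢0⇒n>0 l≢0) (n≢0⇒n>0 r≢0) l≤ r≤

-- The colouring of triples.

-- For |x| = 1 and |p| = 2: the bit of x at the level where p splits (junk otherwise).
bit : Trie n → Trie n → Bool
bit (leaf _)     (leaf _)     = false
bit (node x₀ x₁) (node p₀ p₁) = branch (size p₀) (size p₁) (0 <ᵇ size x₁) (bit′ p₀) (bit′ p₁)
  where
  bit′ : Trie _ → Bool
  bit′ p = branch (size x₀) (size x₁) false (bit x₀ p) (bit x₁ p)

bit-pad : ∀ d d′ (x p : Trie n) → size x ≡ 1 → size p ≡ 2 → bit (pad d x) (pad d′ p) ≡ bit x p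
bit-pad {n} false false x p x≡1 p≡2 rewrite size-none n | x≡1 | p≡2 = refl
bit-pad {n} false true  x p x≡1 p≡2 rewrite size-none n | x≡1 = refl
bit-pad {n} true  false x p x≡1 p≡2 rewrite size-none n | p≡2 = refl
bit-pad {n} true  true  x p x≡1 p≡2 rewrite size-none n = refl

∈-levels-node : ∀ {b} (l r : Trie n) → suc b ∈ levels (node l r) → ∃ λ d → b ∈ levels (child d l r)
∈-levels-node l r b∈ with x∈p∪q⁻ (levels l) (levels r) (drop-there b∈)
... | inj₁ b∈l = false , b∈l
... | inj₂ b∈r = true , b∈r

zero∈-levels-node : (l r : Trie n) → zero ∈ levels (node l r) → 1 ≤ size l × 1 ≤ size r
zero∈-levels-node l r 0∈ with size l | size r | 0∈
... | suc _ | suc _ | _ = s≤s z≤n , s≤s z≤n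

bit-node : ∀ β (x p₀ p₁ : Trie n) → size x ≡ 1 → size p₀ ≡ 1 → size p₁ ≡ 1 →
           bit (pad β x) (node p₀ p₁) ≡ β
bit-node {n} false x p₀ p₁ x≡1 p₀≡1 p₁≡1 rewrite p₀≡1 | p₁≡1 | size-none n = refl
bit-node     true  x p₀ p₁ x≡1 p₀≡1 p₁≡1 rewrite p₀≡1 | p₁≡1 | x≡1         = refl

≤-size-child : ∀ {k} d {l r : Trie n} → k ≤ size l → k ≤ size r → k ≤ size (child d l r)
≤-size-child false k≤l _ = k≤l
≤-size-child true  _ k≤r = k≤r

-- Let both sides have a branching node at level `b`. One leaf from each side of the node in `r`
-- gives a pair that splits at `b`. Below the node in `l` there are vectors with either bit at `b`,
-- and `x` is one with bit `β`.
common-level⇒bit : ∀ β {b} (l r : Trie n) → b ∈ levels l → b ∈ levels r →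
  ∃₂ λ x p → (x ⊑ l × size x ≡ 1) × (p ⊑ r × size p ≡ 2) × bit x p ≡ β
common-level⇒bit {suc n} β {zero} (node l₀ l₁) (node r₀ r₁) 0∈l 0∈r
  with 1≤l₀ , 1≤l₁ ← zero∈-levels-node l₀ l₁ 0∈l
  with 1≤r₀ , 1≤r₁ ← zero∈-levels-node r₀ r₁ 0∈r
  with p₀ , p₀⊑ , p₀≡1 ← shrink 1 r₀ 1≤r₀
  with p₁ , p₁⊑ , p₁≡1 ← shrink 1 r₁ 1≤r₁
  with x , x⊑ , x≡1 ← shrink 1 (child β l₀ l₁) (≤-size-child β 1≤l₀ 1≤l₁) =
  pad β x , node p₀ p₁ , (pad-⊑ β x⊑ , trans (size-pad β x) x≡1) ,
  (node p₀⊑ p₁⊑ , cong₂ _+_ p₀≡1 p₁≡1) , bit-node β x p₀ p₁ x≡1 p₀≡1 p₁≡1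
common-level⇒bit β {suc b} (node l₀ l₁) (node r₀ r₁) b∈l b∈r
  with d , b∈l′ ← ∈-levels-node l₀ l₁ b∈l
  with d′ , b∈r′ ← ∈-levels-node r₀ r₁ b∈r
  with x , p , (x⊑ , x≡1) , (p⊑ , p≡2) , bit≡ ← common-level⇒bit β _ _ b∈l′ b∈r′ =
  pad d x , pad d′ p , (pad-⊑ d x⊑ , trans (size-pad d x) x≡1) ,
  (pad-⊑ d′ p⊑ , trans (size-pad d′ p) p≡2) , trans (bit-pad d d′ x p x≡1 p≡2) bit≡

∣p∣+∣q∣≤∣p∪q∣ : (p q : Subset n) → Empty (p ∩ q) → ∣ p ∣ + ∣ q ∣ ≤ ∣ p ∪ q ∣
∣p∣+∣q∣≤∣p∪q∣ []            []            _     = z≤n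
∣p∣+∣q∣≤∣p∪q∣ (inside  ∷ p) (inside  ∷ q) empty = contradiction (zero , here) empty
∣p∣+∣q∣≤∣p∪q∣ (inside  ∷ p) (outside ∷ q) empty = s≤s (∣p∣+∣q∣≤∣p∪q∣ p q (drop-∷-Empty empty))
∣p∣+∣q∣≤∣p∪q∣ (outside ∷ p) (inside  ∷ q) empty =
  ≤-trans (≤-reflexive (+-suc ∣ p ∣ ∣ q ∣)) (s≤s (∣p∣+∣q∣≤∣p∪q∣ p q (drop-∷-Empty empty)))
∣p∣+∣q∣≤∣p∪q∣ (outside ∷ p) (outside ∷ q) empty = ∣p∣+∣q∣≤∣p∪q∣ p q (drop-∷-Empty empty)

bitColour : Trie n → Trie n → Fin 3
bitColour l r = if size l ≡ᵇ 1 then (if bit l r then 1F else 0F) else 2F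

∣levels-child∣≤ : ∀ d (l r : Trie n) → ∣ levels (child d l r) ∣ ≤ ∣ levels l ∪ levels r ∣
∣levels-child∣≤ false l r = ∣p∣≤∣p∪q∣ (levels l) (levels r)
∣levels-child∣≤ true  l r = ∣q∣≤∣p∪q∣ (levels l) (levels r)

∣levels-node∣ : (l r : Trie n) → 1 ≤ size l → 1 ≤ size r →
                ∣ levels (node l r) ∣ ≡ suc ∣ levels l ∪ levels r ∣
∣levels-node∣ l r 1≤l 1≤r = cong (λ s → ∣ s ∷ (levels l ∪ levels r) ∣) (branch-both 1≤l 1≤r)

-- Counting levels instead of using the depth makes the induction go through. If the two sides have
-- disjoint levels, the leaves in excess of one add up, and the level of the root pays for the
-- second free leaf. If the left side is a single leaf, the level of the root pays for that leaf.
bitColour-hits : ∀ i (S : Trie n) → Hits bitColour 0F 2 i S ⊎ size S ≤ suc ∣ levels S ∣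
bitColour-hits i = hits⊎bounded (λ S → suc ∣ levels S ∣) (λ _ → s≤s z≤n)
  (λ d l r → s≤s (≤-trans (∣levels-child∣≤ d l r) 
    (∣p∣≤∣x∷p∣ (branch (size l) (size r) inside outside outside) (levels l ∪ levels r))))
  (split i)
  where
  open ≤-Reasoning

  split-bit : ∀ β i → (∀ {m} (x p : Trie m) → size x ≡ 1 → bit x p ≡ β → bitColour x p ≡ i) →
    ∀ {m} (l r : Trie m) → 1 ≤ size l → 1 ≤ size r →
    size l ≤ suc ∣ levels l ∣ → size r ≤ suc ∣ levels r ∣ →
    Hits bitColour 0F 2 i (node l r) ⊎ size (node l r) ≤ suc ∣ levels (node l r) ∣
  split-bit β i colour l r 1≤l 1≤r l≤ r≤ with nonempty? (levels l ∩ levels r)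
  ... | yes (b , b∈)
    with b∈l , b∈r ← x∈p∩q⁻ (levels l) (levels r) b∈
    with x , p , (x⊑ , x≡1) , (p⊑ , p≡2) , bit≡ ← common-level⇒bit β l r b∈l b∈r =
    inj₁ (hits-node x⊑ p⊑ (≤-reflexive (sym x≡1)) (≤-trans (s≤s z≤n) (≤-reflexive (sym p≡2)))
      (cong₂ _+_ x≡1 p≡2) (colour x p x≡1 bit≡))
  ... | no  empty = inj₂ (begin
    size l + size r                          ≤⟨ +-mono-≤ l≤ r≤ ⟩
    suc ∣ levels l ∣ + suc ∣ levels r ∣      ≡⟨ cong suc (+-suc _ _) ⟩
    suc (suc (∣ levels l ∣ + ∣ levels r ∣))  ≤⟨ s≤s (s≤s (∣p∣+∣q∣≤∣p∪q∣ _ _ empty)) ⟩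
    suc (suc ∣ levels l ∪ levels r ∣)        ≡⟨ cong suc (∣levels-node∣ l r 1≤l 1≤r) ⟨
    suc ∣ levels (node l r) ∣                ∎)

  split : ∀ i {m} (l r : Trie m) → 1 ≤ size l → 1 ≤ size r →
    size l ≤ suc ∣ levels l ∣ → size r ≤ suc ∣ levels r ∣ →
    Hits bitColour 0F 2 i (node l r) ⊎ size (node l r) ≤ suc ∣ levels (node l r) ∣
  split 0F = split-bit false 0F λ _ _ → cong₂ (λ s b → if s ≡ᵇ 1 then (if b then 1F else 0F) else 2F)
  split 1F = split-bit true  1F λ _ _ → cong₂ (λ s b → if s ≡ᵇ 1 then (if b then 1F else 0F) else 2F)
  split 2F l r 1≤l 1≤r l≤ r≤ with 2 ≤? size l
  ... | yes 2≤l
    with x , x⊑ , x≡2 ← shrink 2 l 2≤l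
    with y , y⊑ , y≡1 ← shrink 1 r 1≤r =
    inj₁ (hits-node x⊑ y⊑ (≤-trans (s≤s z≤n) (≤-reflexive (sym x≡2))) (≤-reflexive (sym y≡1))
      (cong₂ _+_ x≡2 y≡1) (cong (λ s → if s ≡ᵇ 1 then (if bit x y then 1F else 0F) else 2F) x≡2))
  ... | no  2≰l = inj₂ (begin
    size l + size r                    ≤⟨ +-mono-≤ (s≤s⁻¹ (≰⇒> 2≰l)) r≤ ⟩
    suc (suc ∣ levels r ∣)             ≤⟨ s≤s (s≤s (∣levels-child∣≤ true l r)) ⟩
    suc (suc ∣ levels l ∪ levels r ∣)  ≡⟨ cong suc (∣levels-node∣ l r 1≤l 1≤r) ⟨
    suc ∣ levels (node l r) ∣          ∎)

-- Chains of branching nodes and the combs that they carry.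

-- The largest number of branching nodes, each in the right subtree of the previous one.
rlen : Trie n → ℕ
rlen (leaf _)   = 0
rlen (node l r) = rlen l ⊔ (branch (size l) (size r) 1 0 0 + rlen r)

rlen-child≤ : ∀ d (l r : Trie n) → rlen (child d l r) ≤ rlen (node l r)
rlen-child≤ false l r = m≤m⊔n (rlen l) _
rlen-child≤ true  l r = ≤-trans (m≤n+m (rlen r) (branch (size l) (size r) 1 0 0)) (m≤n⊔m (rlen l) _)

rlen-node> : (l r : Trie n) → 1 ≤ size l → 1 ≤ size r → rlen r < rlen (node l r)
rlen-node> l r 1≤l 1≤r = subst (λ b → b + rlen r ≤ rlen (node l r)) (branch-both 1≤l 1≤r) (m≤n⊔m (rlen l) _)

rlen-mirror-child≤ : ∀ d (l r : Trie n) → rlen (mirror (child d l r)) ≤ rlen (mirror (node l r))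
rlen-mirror-child≤ false l r = rlen-child≤ true  (mirror r) (mirror l)
rlen-mirror-child≤ true  l r = rlen-child≤ false (mirror r) (mirror l)

rlen-mirror-node> : (l r : Trie n) → 1 ≤ size l → 1 ≤ size r →
                    rlen (mirror l) < rlen (mirror (node l r))
rlen-mirror-node> l r 1≤l 1≤r = rlen-node> (mirror r) (mirror l)
  (subst (1 ≤_) (sym (size-mirror r)) 1≤r) (subst (1 ≤_) (sym (size-mirror l)) 1≤l)

rlen-empty : (e : Trie n) → size e ≡ 0 → rlen e ≡ 0
rlen-empty (leaf _)   _   = refl
rlen-empty (node l r) e≡0
  with l≡0 ← m+n≡0⇒m≡0 (size l) e≡0 | r≡0 ← m+n≡0⇒n≡0 (size l) e≡0
  rewrite rlen-empty l l≡0 | rlen-empty r r≡0 | l≡0 | r≡0 = refl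

-- An inductive family, so that first-split values on a comb can be computed by recursion on its
-- shape.
data RightComb : ∀ {n} → Trie n → Set where
  single : {e : Trie n} → size e ≡ 1 → RightComb e
  skip   : ∀ d {e : Trie n} → 1 ≤ size e → RightComb e → RightComb (pad d e)
  cons   : {x e : Trie n} → size x ≡ 1 → 1 ≤ size e → RightComb e → RightComb (node x e)

-- Every subset of D is realised as the set of levels of a right comb in S.
RightChain : Trie n → Subset n → Set
RightChain S D = ∀ D′ → D′ ⊆ D → ∃ λ e → e ⊑ S × size e ≡ suc ∣ D′ ∣ × levels e ≡ D′ × RightComb e

levels-≤1 : (e : Trie n) → size e ≤ 1 → levels e ≡ ⊥
levels-≤1 (leaf _)   _ = refl
levels-≤1 (node l r) e≤1 = cong₂ _∷_ (not-both (size l) (size r) e≤1)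
  (trans (cong₂ _∪_ (levels-≤1 l (m+n≤o⇒m≤o (size l) e≤1)) (levels-≤1 r (m+n≤o⇒n≤o (size l) e≤1)))
         (∪-identityˡ ⊥))
  where
  not-both : ∀ x y → x + y ≤ 1 → branch x y inside outside outside ≡ outside
  not-both zero          _       _        = refl
  not-both (suc _)       zero    _        = refl
  not-both (suc zero)    (suc _) (s≤s ())
  not-both (suc (suc _)) (suc _) (s≤s ())

rightChain-child : ∀ d (l r : Trie n) {D} →
                   RightChain (child d l r) D → RightChain (node l r) (outside ∷ D)
rightChain-child d l r chain (inside ∷ D′) D′⊆ with () ← D′⊆ here
rightChain-child d l r chain (outside ∷ D′) D′⊆
  with e , e⊑ , ∣e∣≡ , levels≡ , comb ← chain D′ (drop-∷-⊆ D′⊆) =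
  pad d e , pad-⊑ d e⊑ , trans (size-pad d e) ∣e∣≡ ,
  trans (levels-pad d e) (cong (outside ∷_) levels≡) , skip d (1≤-suc ∣e∣≡) comb

-- A `D′` that contains the new level is realised by one leaf of `l` in front of a comb in `r`; any
-- other `D′` is realised in `r` alone.
rightChain-cons : (l r : Trie n) {D : Subset n} → 1 ≤ size l →
                  RightChain r D → RightChain (node l r) (inside ∷ D)
rightChain-cons {n} l r 1≤l chain (inside ∷ D′) D′⊆
  with x , x⊑ , x≡1 ← shrink 1 l 1≤l
  with e , e⊑ , ∣e∣≡ , levels≡ , comb ← chain D′ (drop-∷-⊆ D′⊆) =
  node x e , node x⊑ e⊑ , cong₂ _+_ x≡1 ∣e∣≡ ,
  cong₂ _∷_ (branch-both (1≤-suc x≡1) (1≤-suc ∣e∣≡))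
    (trans (cong (_∪ levels e) (levels-≤1 x (≤-reflexive x≡1))) (trans (∪-identityˡ (levels e)) levels≡)) ,
  cons x≡1 (1≤-suc ∣e∣≡) comb
rightChain-cons l r 1≤l chain (outside ∷ D′) D′⊆ =
  rightChain-child true l r chain (outside ∷ D′) (out⊆ (drop-∷-⊆ D′⊆))

-- Follows the maximum in `rlen`: a longest chain lies within `l`, or starts at the root and
-- continues in `r`. The nodes of a chain lie on different levels, so `D` counts them.
longestRightChain : (S : Trie n) → 1 ≤ size S → ∃ λ D → ∣ D ∣ ≡ rlen S × RightChain S D
longestRightChain (leaf true) _ = [] , refl , λ where [] _ → leaf true , leaf b≤b , refl , refl , single refl
longestRightChain (node l r) 1≤S with size l ≟ 0 | size r ≟ 0
... | yes l≡0 | _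
  with D , ∣D∣≡ , chain ← longestRightChain r (subst (λ s → 1 ≤ s + size r) l≡0 1≤S) =
  outside ∷ D , trans ∣D∣≡ (rlen-skip l≡0) , rightChain-child true l r chain
  where
  rlen-skip : size l ≡ 0 → rlen r ≡ rlen (node l r)
  rlen-skip l≡0 rewrite rlen-empty l l≡0 | l≡0 = refl
... | no l≢0 | yes r≡0
  with D , ∣D∣≡ , chain ← longestRightChain l (n≢0⇒n>0 l≢0) =
  outside ∷ D , trans ∣D∣≡ (rlen-skip r≡0) , rightChain-child false l r chain
  where
  rlen-skip : size r ≡ 0 → rlen l ≡ rlen (node l r)
  rlen-skip r≡0 rewrite rlen-empty r r≡0 | r≡0 with size l
  ... | zero  = sym (⊔-identityʳ (rlen l))
  ... | suc _ = sym (⊔-identityʳ (rlen l))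
... | no l≢0 | no r≢0 with n≢0⇒n>0 l≢0 | n≢0⇒n>0 r≢0
... | 1≤l | 1≤r
  with rlen≡ ← cong (λ b → rlen l ⊔ (b + rlen r)) (branch-both 1≤l 1≤r)
  with ≤-total (suc (rlen r)) (rlen l)
...   | inj₁ r<l
  with D , ∣D∣≡ , chain ← longestRightChain l 1≤l =
  outside ∷ D , trans ∣D∣≡ (sym (trans rlen≡ (m≥n⇒m⊔n≡m r<l))) ,
  rightChain-child false l r chain
...   | inj₂ l≤
  with D , ∣D∣≡ , chain ← longestRightChain r 1≤r =
  inside ∷ D , trans (cong suc ∣D∣≡) (sym (trans rlen≡ (m≤n⇒m⊔n≡n l≤))) ,
  rightChain-cons l r 1≤l chain

-- Bounds for tries that miss a pattern.

-- For 3 leaves this says that the trie is not a right comb.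
turns : Trie n → Bool
turns = onSplit (λ l _ → 2 ≤ᵇ size l) false

turns-rightComb : {e : Trie n} → RightComb e → turns e ≡ false
turns-rightComb (single {e = e} e≡1) = turns-single e e≡1
  where
  turns-single : ∀ {n} (e : Trie n) → size e ≡ 1 → turns e ≡ false
  turns-single (leaf _)   _ = refl
  turns-single (node l r) e≡1 with size l in l≡ | size r in r≡
  ... | zero     | _    = turns-single r (trans r≡ e≡1)
  ... | suc zero | zero = turns-single l l≡
turns-rightComb (skip d {e = e} 1≤e comb) = trans (onSplit-pad d _ false e 1≤e) (turns-rightComb comb)
turns-rightComb (cons x≡1 1≤e comb) =
  trans (branch-both (1≤-suc x≡1) 1≤e) (cong (2 ≤ᵇ_) x≡1)

-- The first split of a right comb cuts off one leaf and leaves a right comb, which does not turn.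
-- For `kind` this gives `nothing`, so combs inherit their colour.
onSplit-rightComb : ∀ (f : ∀ {m} → Trie m → Trie m → A) a {c k} {e : Trie n} → 1 ≤ k →
  (∀ {m} (x y : Trie m) → size x ≡ 1 → size y ≡ k → turns y ≡ false → f x y ≡ c) →
  RightComb e → size e ≡ suc k → onSplit f a e ≡ c
onSplit-rightComb f a 1≤k f≡ (single e≡1) e≡ = contradiction (trans (sym e≡1) e≡) (<⇒≢ (s≤s 1≤k))
onSplit-rightComb f a 1≤k f≡ (skip d {e = e} 1≤e comb) e≡ =
  trans (onSplit-pad d f a e 1≤e) (onSplit-rightComb f a 1≤k f≡ comb (trans (sym (size-pad d e)) e≡))
onSplit-rightComb f a 1≤k f≡ (cons {x = x} {e = e} x≡1 1≤e comb) e≡ =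
  trans (branch-both (1≤-suc x≡1) 1≤e)
    (f≡ x e x≡1 (suc-injective (trans (cong (_+ size e) (sym x≡1)) e≡)) (turns-rightComb comb))

-- In the absence of a hit, a branching node with more than `k` leaves has a single leaf on its
-- left. Passing to the right side loses this leaf and lowers `rlen`.
turning⊎bounded : ∀ k → 2 ≤ k → (S : Trie n) →
  Hits (λ l _ → 2 ≤ᵇ size l) false k true S ⊎ size S ≤ k + rlen S
turning⊎bounded k 2≤k = hits⊎bounded (λ S → k + rlen S) (λ _ → ≤-trans (<⇒≤ 2≤k) (m≤m+n k 0))
  (λ d l r → +-monoʳ-≤ k (rlen-child≤ d l r)) split
  where
  open ≤-Reasoning
  split : ∀ {m} (l r : Trie m) → 1 ≤ size l → 1 ≤ size r → size l ≤ k + rlen l → size r ≤ k + rlen r →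
    Hits (λ l _ → 2 ≤ᵇ size l) false k true (node l r) ⊎ size (node l r) ≤ k + rlen (node l r)
  split l r 1≤l 1≤r l≤ r≤ with 2 ≤? size l | suc k ≤? size l + size r
  ... | yes 2≤l | yes k<
    with i , j , (2≤i , i≤) , (1≤j , j≤) , i+j≡ ← +-split 2 1 2≤l 1≤r (s≤s 2≤k) k<
    with x , x⊑ , x≡ ← shrink i l i≤
    with y , y⊑ , y≡ ← shrink j r j≤ =
    inj₁ (hits-node x⊑ y⊑ (≤-trans (<⇒≤ 2≤i) (≤-reflexive (sym x≡))) (≤-trans 1≤j (≤-reflexive (sym y≡)))
      (trans (cong₂ _+_ x≡ y≡) i+j≡) (≤ᵇ-true (subst (2 ≤_) (sym x≡) 2≤i)))
    where
    ≤ᵇ-true : ∀ {s} → 2 ≤ s → (2 ≤ᵇ s) ≡ true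
    ≤ᵇ-true (s≤s (s≤s _)) = refl
  ... | _ | no k≮ = inj₂ (≤-trans (s≤s⁻¹ (≰⇒> k≮)) (m≤m+n k _))
  ... | no 2≰l | _ = inj₂ (begin
    size l + size r     ≤⟨ +-mono-≤ (s≤s⁻¹ (≰⇒> 2≰l)) r≤ ⟩
    suc (k + rlen r)    ≡⟨ +-suc k (rlen r) ⟨
    k + suc (rlen r)    ≤⟨ +-monoʳ-≤ k (rlen-node> l r 1≤l 1≤r) ⟩
    k + rlen (node l r) ∎)

-- A turning subtrie on the right of a node, together with one leaf on the left, is a hit. Otherwise
-- every right side has at most `k + rlen S` leaves. Descending to the left peels off one right side
-- per branching node, and at most `rlen (mirror S)` of them.
rightThenTurn⊎bounded : ∀ (f : ∀ {m} → Trie m → Trie m → A) a {c} k → 2 ≤ k →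
  (∀ {m} (x y : Trie m) → size x ≡ 1 → size y ≡ suc k → turns y ≡ true → f x y ≡ c) →
  (S : Trie n) → Hits f a (suc k) c S ⊎ size S ≤ (k + rlen S) * suc (rlen (mirror S))
rightThenTurn⊎bounded f a {c} k 2≤k f≡ =
  hits⊎bounded B (λ _ → *-mono-≤ (≤-trans (<⇒≤ 2≤k) (m≤m+n k 0)) (≤-refl {1}))
    (λ d l r → *-mono-≤ (+-monoʳ-≤ k (rlen-child≤ d l r)) (s≤s (rlen-mirror-child≤ d l r))) split
  where
  open ≤-Reasoning
  B : ∀ {n} → Trie n → ℕ
  B S = (k + rlen S) * suc (rlen (mirror S))
  split : ∀ {m} (l r : Trie m) → 1 ≤ size l → 1 ≤ size r → size l ≤ B l → size r ≤ B r →
    Hits f a (suc k) c (node l r) ⊎ size (node l r) ≤ B (node l r)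
  split l r 1≤l 1≤r l≤ r≤ with turning⊎bounded k 2≤k r
  ... | inj₁ (y , y⊑ , y≡ , turn)
    with x , x⊑ , x≡1 ← shrink 1 l 1≤l =
    inj₁ (hits-node x⊑ y⊑ (1≤-suc x≡1) (1≤-suc y≡) (cong₂ _+_ x≡1 y≡) (f≡ x y x≡1 y≡ turn))
  ... | inj₂ r≤′ = inj₂ (begin
    size l + size r                              ≤⟨ +-mono-≤ l≤ r≤′ ⟩
    B l + (k + rlen r)                           ≡⟨ +-comm (B l) _ ⟩
    (k + rlen r) + B l
      ≤⟨ +-mono-≤ (+-monoʳ-≤ k (rlen-child≤ true l r)) (*-monoˡ-≤ _ (+-monoʳ-≤ k (rlen-child≤ false l r))) ⟩
    (k + rlen (node l r)) + (k + rlen (node l r)) * suc (rlen (mirror l))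
      ≡⟨ *-suc (k + rlen (node l r)) _ ⟨
    (k + rlen (node l r)) * suc (suc (rlen (mirror l)))
      ≤⟨ *-monoʳ-≤ (k + rlen (node l r)) (s≤s (rlen-mirror-node> l r 1≤l 1≤r)) ⟩
    B (node l r)                                 ∎)

-- In the absence of a hit, a branching node with more than `k` leaves has a single leaf on one
-- side. It is charged to the right chain if it lies on the left, and to the left chain if it lies
-- on the right.
balanced⊎bounded : ∀ (f : ∀ {m} → Trie m → Trie m → A) a {c} k → 3 ≤ k →
  (∀ {m} (x y : Trie m) → 2 ≤ size x → 2 ≤ size y → f x y ≡ c) →
  (S : Trie n) → Hits f a k c S ⊎ size S ≤ k + (rlen S + rlen (mirror S))
balanced⊎bounded f a {c} k 3≤k f≡ =
  hits⊎bounded B (λ _ → ≤-trans (≤-trans (s≤s z≤n) 3≤k) (m≤m+n k 0))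
    (λ d l r → +-monoʳ-≤ k (+-mono-≤ (rlen-child≤ d l r) (rlen-mirror-child≤ d l r))) split
  where
  open ≤-Reasoning
  B : ∀ {n} → Trie n → ℕ
  B S = k + (rlen S + rlen (mirror S))
  split : ∀ {m} (l r : Trie m) → 1 ≤ size l → 1 ≤ size r → size l ≤ B l → size r ≤ B r →
    Hits f a k c (node l r) ⊎ size (node l r) ≤ B (node l r)
  split l r 1≤l 1≤r l≤ r≤ with 2 ≤? size l | 2 ≤? size r | suc k ≤? size l + size r
  ... | yes 2≤l | yes 2≤r | yes k<
    with i , j , (2≤i , i≤) , (2≤j , j≤) , i+j≡ ← +-split 2 2 2≤l 2≤r (s≤s 3≤k) k<
    with x , x⊑ , x≡ ← shrink i l i≤
    with y , y⊑ , y≡ ← shrink j r j≤ =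
    inj₁ (hits-node x⊑ y⊑ (<⇒≤ (subst (2 ≤_) (sym x≡) 2≤i)) (<⇒≤ (subst (2 ≤_) (sym y≡) 2≤j))
      (trans (cong₂ _+_ x≡ y≡) i+j≡) (f≡ x y (subst (2 ≤_) (sym x≡) 2≤i) (subst (2 ≤_) (sym y≡) 2≤j)))
  ... | _ | _ | no k≮ = inj₂ (≤-trans (s≤s⁻¹ (≰⇒> k≮)) (m≤m+n k _))
  ... | no 2≰l | _ | _ = inj₂ (begin
    size l + size r                                ≤⟨ +-mono-≤ (s≤s⁻¹ (≰⇒> 2≰l)) r≤ ⟩
    suc (k + (rlen r + rlen (mirror r)))           ≡⟨ +-suc k _ ⟨
    k + (suc (rlen r) + rlen (mirror r))
      ≤⟨ +-monoʳ-≤ k (+-mono-≤ (rlen-node> l r 1≤l 1≤r) (rlen-mirror-child≤ true l r)) ⟩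
    B (node l r)                                   ∎)
  ... | _ | no 2≰r | _ = inj₂ (begin
    size l + size r                                ≤⟨ +-mono-≤ l≤ (s≤s⁻¹ (≰⇒> 2≰r)) ⟩
    k + (rlen l + rlen (mirror l)) + 1             ≡⟨ +-assoc k _ 1 ⟩
    k + (rlen l + rlen (mirror l) + 1)             ≡⟨ cong (k +_) (+-assoc (rlen l) _ 1) ⟩
    k + (rlen l + (rlen (mirror l) + 1))           ≡⟨ cong (λ s → k + (rlen l + s)) (+-comm _ 1) ⟩
    k + (rlen l + suc (rlen (mirror l)))
      ≤⟨ +-monoʳ-≤ k (+-mono-≤ (rlen-child≤ false l r) (rlen-mirror-node> l r 1≤l 1≤r)) ⟩
    B (node l r)                                   ∎)

-- Rainbow colourings and the stepping-up construction.

-- The colouring is total on subsets, so that no proofs of size have to be carried along; sets with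
-- `t` or more elements are included to make the property monotone in `t`.
Rainbow : ℕ → ℕ → ℕ → Set
Rainbow n k t = Σ (Subset n → Fin 3) λ χ →
  ∀ S → t ≤ ∣ S ∣ → ∀ i → ∃ λ e → e ⊆ S × ∣ e ∣ ≡ k × χ e ≡ i

TrieRainbow : ℕ → ℕ → ℕ → Set
TrieRainbow n k t = Σ (Trie n → Fin 3) λ χ →
  ∀ S → t ≤ size S → ∀ i → ∃ λ e → e ⊑ S × size e ≡ k × χ e ≡ i

-- The value `nothing` stands for an inherited colour. Reflecting the trie exchanges the patterns
-- `0F` and `1F` once there are at least three leaves, for then the two sides are not both single.
kind : Trie n → Trie n → Maybe (Fin 3)
kind l r =
  if size l ≡ᵇ 1 then (if turns r then just 0F else nothing)
  else if size r ≡ᵇ 1 then (if turns (mirror l) then just 1F else nothing)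
  else just 2F

kindʳ : ∀ {b} (x y : Trie n) → size x ≡ 1 → turns y ≡ b → kind x y ≡ (if b then just 0F else nothing)
kindʳ x y x≡1 refl rewrite x≡1 = refl

kindˡ : ∀ {k b} (x y : Trie n) → size x ≡ 1 → size y ≡ 2 + k → turns y ≡ b →
        kind (mirror y) (mirror x) ≡ (if b then just 1F else nothing)
kindˡ x y x≡1 y≡ refl rewrite size-mirror x | size-mirror y | x≡1 | y≡ | mirror-involutive y = refl

kind-balanced : (x y : Trie n) → 2 ≤ size x → 2 ≤ size y → kind x y ≡ just 2F
kind-balanced x y 2≤x 2≤y with size x | size y | 2≤x | 2≤y
... | suc (suc _) | suc (suc _) | _ | _ = refl
... | suc zero    | _           | s≤s () | _
... | suc (suc _) | suc zero    | _ | s≤s ()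

-- A comb with `suc k` leaves has exactly `k` levels; it is on these `k`-sets that the rainbow
-- property of `χ` is applied.
stepColour : (Subset n → Fin 3) → Trie n → Fin 3
stepColour χ e = fromMaybe (χ (levels e)) (onSplit kind nothing e)

trieRainbow-step : ∀ {k t} → 3 ≤ k → Rainbow n k t → TrieRainbow n (suc k) ((k + t) * suc t)
trieRainbow-step {n} {k@(suc k′@(suc _))} {t} 3≤k@(s≤s 2≤k′) (χ , rainbow) = stepColour χ , hit
  where
  open ≤-Reasoning

  Hit : Fin 3 → Trie n → Set
  Hit i S = ∃ λ e → e ⊑ S × size e ≡ suc k × stepColour χ e ≡ i

  chain-hit : ∀ i S → 1 ≤ size S → t ≤ rlen S →
    ∃ λ e → e ⊑ S × size e ≡ suc k × χ (levels e) ≡ i × RightComb e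
  chain-hit i S 1≤S t≤
    with D , ∣D∣≡ , chain ← longestRightChain S 1≤S
    with D′ , D′⊆ , ∣D′∣≡ , χ≡ ← rainbow D (≤-trans t≤ (≤-reflexive (sym ∣D∣≡))) i
    with e , e⊑ , ∣e∣≡ , levels≡ , comb ← chain D′ D′⊆ =
    e , e⊑ , trans ∣e∣≡ (cong suc ∣D′∣≡) , trans (cong χ levels≡) χ≡ , comb

  right-hit : ∀ i S → 1 ≤ size S → t ≤ rlen S → Hit i S
  right-hit i S 1≤S t≤ with e , e⊑ , e≡ , χ≡ , comb ← chain-hit i S 1≤S t≤ =
    e , e⊑ , e≡ , trans (cong (fromMaybe _) (onSplit-rightComb kind nothing (s≤s z≤n)
      (λ x y x≡1 _ → kindʳ x y x≡1) comb e≡)) χ≡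

  -- Left combs are treated as right combs in the mirror image, which has the same levels and hence
  -- the same inherited colour.
  left-hit : ∀ i S → 1 ≤ size S → t ≤ rlen (mirror S) → Hit i S
  left-hit i S 1≤S t≤
    with e , e⊑ , e≡ , χ≡ , comb ← chain-hit i (mirror S) (subst (1 ≤_) (sym (size-mirror S)) 1≤S) t≤ =
    mirror e , subst (mirror e ⊑_) (mirror-involutive S) (mirror-⊑ e⊑) , trans (size-mirror e) e≡ ,
    trans (cong (fromMaybe _) (trans (onSplit-mirror kind nothing e)
            (onSplit-rightComb (λ l r → kind (mirror r) (mirror l)) nothing (s≤s z≤n)
              (λ x y → kindˡ x y) comb e≡)))
          (trans (cong χ (levels-mirror e)) χ≡)

  kind-hit : ∀ i S → Hits kind nothing k (just i) S → Hit i S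
  kind-hit i S (e , e⊑ , e≡ , kind≡) = e , e⊑ , e≡ , cong (fromMaybe _) kind≡

  mirror-kind-hit : ∀ i S → Hits (λ l r → kind (mirror r) (mirror l)) nothing k (just i) (mirror S) →
                    Hit i S
  mirror-kind-hit i S (e , e⊑ , e≡ , kind≡) =
    mirror e , subst (mirror e ⊑_) (mirror-involutive S) (mirror-⊑ e⊑) , trans (size-mirror e) e≡ ,
    cong (fromMaybe _) (trans (onSplit-mirror kind nothing e) kind≡)

  turn-bound : ∀ {a b} → a < t → b < t → (k′ + a) * suc b < (k + t) * suc t
  turn-bound {a} {b} a<t b<t = begin-strict
    (k′ + a) * suc b ≤⟨ *-mono-≤ (+-monoʳ-≤ k′ (<⇒≤ a<t)) (<⇒≤ (s≤s b<t)) ⟩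
    (k′ + t) * suc t <⟨ m<n+m _ (s≤s z≤n) ⟩
    (k + t) * suc t  ∎

  balanced-bound : ∀ {a b} → a < t → b < t → k + (a + b) < (k + t) * suc t
  balanced-bound {a} {b} a<t b<t = begin-strict
    k + (a + b)             ≡⟨ +-assoc k a b ⟨
    k + a + b               <⟨ +-mono-< (+-monoʳ-< k a<t) b<t ⟩
    k + t + t               ≤⟨ +-monoʳ-≤ (k + t) (m≤m+n t _) ⟩
    (k + t) + (k + t) * t   ≡⟨ *-suc (k + t) t ⟨
    (k + t) * suc t         ∎

  hit : ∀ S → (k + t) * suc t ≤ size S → ∀ i → Hit i S
  hit S large i with t ≤? rlen S | t ≤? rlen (mirror S)
  ... | yes t≤ | _      = right-hit i S (≤-trans (s≤s z≤n) large) t≤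
  ... | no _   | yes t≤ = left-hit i S (≤-trans (s≤s z≤n) large) t≤
  ... | no t≰  | no t≰′ = unchained i
    where
    unchained : ∀ i → Hit i S
    -- The pattern consists of one leaf and a turning set of `k = suc k′` leaves, hence the
    -- parameter `k′`.
    unchained 0F with rightThenTurn⊎bounded kind nothing k′ 2≤k′ (λ x y x≡1 _ → kindʳ x y x≡1) S
    ... | inj₁ hits = kind-hit 0F S hits
    ... | inj₂ S≤   = contradiction (≤-trans large S≤) (<⇒≱ (turn-bound (≰⇒> t≰) (≰⇒> t≰′)))
    unchained 1F
      -- Pattern `1F` in `S` is pattern `0F` in the mirror image, where the two chain lengths change
      -- places.
      with rightThenTurn⊎bounded (λ l r → kind (mirror r) (mirror l)) nothing k′ 2≤k′
             (λ x y → kindˡ x y) (mirror S)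
    ... | inj₁ hits = mirror-kind-hit 1F S hits
    ... | inj₂ S≤   =
      contradiction (≤-trans large (≤-trans (≤-reflexive (sym (size-mirror S))) S≤))
        (<⇒≱ (turn-bound (≰⇒> t≰′) (subst (λ U → rlen U < t) (sym (mirror-involutive S)) (≰⇒> t≰))))
    unchained 2F with balanced⊎bounded kind nothing k 3≤k kind-balanced S
    ... | inj₁ hits = kind-hit 2F S hits
    ... | inj₂ S≤   = contradiction (≤-trans large S≤) (<⇒≱ (balanced-bound (≰⇒> t≰) (≰⇒> t≰′)))

trieRainbow₃ : ∀ n → TrieRainbow n 3 (2 + n)
trieRainbow₃ n = onSplit bitColour 0F , hit
  where
  hit : ∀ S → 2 + n ≤ size S → ∀ i → Hits bitColour 0F 2 i S
  hit S large i with bitColour-hits i S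
  ... | inj₁ hits = hits
  ... | inj₂ S≤   = contradiction (≤-trans large S≤) (<⇒≱ (s≤s (s≤s (∣p∣≤n (levels S)))))

-- From tries to subsets, and fewer vertices.

-- The trailing `[]` in the body matches `2 ^ suc n`, which unfolds to `2 ^ n + (2 ^ n + 0)`.
toSubset : Trie n → Subset (2 ^ n)
toSubset (leaf b)   = b ∷ []
toSubset (node l r) = toSubset l ++ (toSubset r ++ [])

fromSubset : ∀ n → Subset (2 ^ n) → Trie n
fromSubset zero    (b ∷ []) = leaf b
fromSubset (suc n) p        = node (fromSubset n (take (2 ^ n) p)) (fromSubset n (take (2 ^ n) (drop (2 ^ n) p)))

∣p++q∣ : ∀ {m} (p : Subset m) (q : Subset n) → ∣ p ++ q ∣ ≡ ∣ p ∣ + ∣ q ∣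
∣p++q∣ []            q = refl
∣p++q∣ (inside  ∷ p) q = cong suc (∣p++q∣ p q)
∣p++q∣ (outside ∷ p) q = ∣p++q∣ p q

++-⊆ : ∀ {m} {p p′ : Subset m} {q q′ : Subset n} → p ⊆ p′ → q ⊆ q′ → p ++ q ⊆ p′ ++ q′
++-⊆ {p = []}    {[]}     p⊆ q⊆ x∈         = q⊆ x∈
++-⊆ {p = _ ∷ p} {_ ∷ p′} p⊆ q⊆ here with here ← p⊆ here = here
++-⊆ {p = _ ∷ p} {_ ∷ p′} p⊆ q⊆ (there x∈) = there (++-⊆ (drop-∷-⊆ p⊆) q⊆ x∈)

∣toSubset∣ : (e : Trie n) → ∣ toSubset e ∣ ≡ size e
∣toSubset∣ (leaf true)  = refl
∣toSubset∣ (leaf false) = refl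
∣toSubset∣ (node l r)
  rewrite ∣p++q∣ (toSubset l) (toSubset r ++ []) | ∣p++q∣ (toSubset r) []
        | +-identityʳ ∣ toSubset r ∣ | ∣toSubset∣ l | ∣toSubset∣ r = refl

toSubset-⊆ : {e S : Trie n} → e ⊑ S → toSubset e ⊆ toSubset S
toSubset-⊆ (leaf b≤b)   = ⊆-refl
toSubset-⊆ (leaf f≤t)   = out⊆ ⊆-refl
toSubset-⊆ (node l⊑ r⊑) = ++-⊆ (toSubset-⊆ l⊑) (++-⊆ (toSubset-⊆ r⊑) ⊆-refl)

take-++ : ∀ {m} (p : Subset m) (q : Subset n) → take m (p ++ q) ≡ p
take-++ []      q = refl
take-++ (x ∷ p) q = cong (x ∷_) (take-++ p q)

drop-++ : ∀ {m} (p : Subset m) (q : Subset n) → drop m (p ++ q) ≡ q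
drop-++ []      q = refl
drop-++ (_ ∷ p) q = drop-++ p q

fromSubset-toSubset : (e : Trie n) → fromSubset n (toSubset e) ≡ e
fromSubset-toSubset (leaf _) = refl
fromSubset-toSubset (node l r)
  rewrite take-++ (toSubset l) (toSubset r ++ []) | drop-++ (toSubset l) (toSubset r ++ [])
        | take-++ (toSubset r) [] = cong₂ node (fromSubset-toSubset l) (fromSubset-toSubset r)

toSubset-fromSubset : ∀ n (p : Subset (2 ^ n)) → toSubset (fromSubset n p) ≡ p
toSubset-fromSubset zero    (b ∷ []) = refl
toSubset-fromSubset (suc n) p
  rewrite toSubset-fromSubset n (take (2 ^ n) p)
        | toSubset-fromSubset n (take (2 ^ n) (drop (2 ^ n) p)) =
  trans (cong (take (2 ^ n) p ++_) (trans (cong (take (2 ^ n) q ++_) (sym (empty (drop (2 ^ n) q))))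
                                          (take++drop≡id (2 ^ n) q)))
        (take++drop≡id (2 ^ n) p)
  where
  q = drop (2 ^ n) p
  empty : (v : Subset 0) → v ≡ []
  empty [] = refl

trieRainbow⇒rainbow : ∀ {k t} → TrieRainbow n k t → Rainbow (2 ^ n) k t
trieRainbow⇒rainbow {n} {k} {t} (χ , rainbow) = (χ ∘′ fromSubset n) , hit
  where
  hit : ∀ S → t ≤ ∣ S ∣ → ∀ i → ∃ λ e → e ⊆ S × ∣ e ∣ ≡ k × χ (fromSubset n e) ≡ i
  hit S t≤ i
    with e , e⊑ , e≡ , χ≡ ← rainbow (fromSubset n S)
           (subst (t ≤_) (trans (cong ∣_∣ (sym (toSubset-fromSubset n S))) (∣toSubset∣ (fromSubset n S))) t≤) i =
    toSubset e , subst (toSubset e ⊆_) (toSubset-fromSubset n S) (toSubset-⊆ e⊑) ,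
    trans (∣toSubset∣ e) e≡ , trans (cong χ (fromSubset-toSubset e)) χ≡

rainbow-pred : ∀ {k t} → Rainbow (suc n) k t → Rainbow n k t
rainbow-pred (χ , rainbow) = (λ e → χ (outside ∷ e)) , λ S t≤ i → restrict (rainbow (outside ∷ S) t≤ i)
  where
  restrict : ∀ {S k i} → (∃ λ e → e ⊆ outside ∷ S × ∣ e ∣ ≡ k × χ e ≡ i) →
             ∃ λ e → e ⊆ S × ∣ e ∣ ≡ k × χ (outside ∷ e) ≡ i
  restrict (inside  ∷ e , e⊆ , _) with () ← e⊆ here
  restrict (outside ∷ e , e⊆ , e≡ , χ≡) = e , drop-∷-⊆ e⊆ , e≡ , χ≡

-- Deleting vertices one at a time yields a colouring on exactly `r` vertices for any `r` below the
-- tower, which is where a Ramsey number `r` has to be refuted.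
rainbow-antitone : ∀ {m k t} → m ≤′ n → Rainbow n k t → Rainbow m k t
rainbow-antitone ≤′-refl        rainbow = rainbow
rainbow-antitone (≤′-step m≤′n) rainbow = rainbow-antitone m≤′n (rainbow-pred rainbow)

rainbow-monotone : ∀ {k t t′} → t ≤ t′ → Rainbow n k t → Rainbow n k t′
rainbow-monotone t≤t′ (χ , rainbow) = χ , λ S t′≤ → rainbow S (≤-trans t≤t′ t′≤)

-- Towers, integer roots and the final estimate.

-- The index is shifted: `tower i` is the integer counterpart of `T (suc i)`.
tower : ℕ → ℕ → ℕ
tower zero    a = a
tower (suc j) a = 2 ^ tower j a

rainbow⇒¬forces : ∀ {n k t} → Rainbow n k t → ¬ Forces k t 3 3 n
rainbow⇒¬forces {n} {k} {t} (χ , rainbow) forces with S , ∣S∣≡t , few ← forces (λ e → χ (proj₁ e)) =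
  <⇒≱ few (p⊆q⇒∣p∣≤∣q∣ {p = ⊤} λ {i} _ → received i)
  where
  χ′ : Colouring k n 3
  χ′ e = χ (proj₁ e)
  received : ∀ i → i ∈ coloursInside χ′ S
  received i with e , e⊆ , e≡ , χ≡ ← rainbow S (≤-reflexive (sym ∣S∣≡t)) i =
    lookup⇒[]= i _ (trans (lookup∘tabulate (λ i → does (receivedInside? χ′ S i)) i)
      (dec-true (receivedInside? χ′ S i) (e , e⊆ , e≡ , χ≡)))

-- The exponent depends on `j` only. A step replaces `a ^ suc d` by a product of two factors that
-- are each at most `2 * a ^ suc d`, hence at most `a ^ (2 + d)`.
rainbow-tower : ∀ j → ∃ λ d → ∀ a → 3 + j ≤ a → Rainbow (tower (suc j) a) (3 + j) (a ^ suc d)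
rainbow-tower zero = 1 , λ a 3≤a → rainbow-monotone (begin
    2 + a       ≤⟨ +-monoˡ-≤ a (<⇒≤ 3≤a) ⟩
    a + a       ≡⟨ cong (a +_) (+-identityʳ a) ⟨
    2 * a       ≤⟨ *-monoˡ-≤ a (<⇒≤ 3≤a) ⟩
    a * a       ≡⟨ cong (a *_) (*-identityʳ a) ⟨
    a ^ 2       ∎) (trieRainbow⇒rainbow (trieRainbow₃ a))
  where open ≤-Reasoning
rainbow-tower (suc j) with d , rainbow ← rainbow-tower j =
  suc (d + (2 + d)) , λ a 4+j≤a → rainbow-monotone (bound d a 4+j≤a)
    (trieRainbow⇒rainbow (trieRainbow-step (s≤s (s≤s (s≤s z≤n))) (rainbow a (<⇒≤ 4+j≤a))))
  where
  open ≤-Reasoning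
  bound : ∀ d a → 4 + j ≤ a → (3 + j + a ^ suc d) * suc (a ^ suc d) ≤ a ^ (2 + d + (2 + d))
  bound d a@(suc _) 4+j≤a = begin
    (3 + j + a ^ suc d) * suc (a ^ suc d)
      ≤⟨ *-mono-≤ (+-monoˡ-≤ _ (≤-trans (<⇒≤ 4+j≤a) (m≤m*n a (a ^ d) {{m^n≢0 a d}})))
                   (+-monoˡ-≤ _ (m^n>0 a (suc d))) ⟩
    (a ^ suc d + a ^ suc d) * (a ^ suc d + a ^ suc d)
      ≤⟨ *-mono-≤ double double ⟩
    a ^ (2 + d) * a ^ (2 + d)
      ≡⟨ ^-distribˡ-+-* a (2 + d) (2 + d) ⟨
    a ^ (2 + d + (2 + d)) ∎
    where
    double : a ^ suc d + a ^ suc d ≤ a ^ (2 + d)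
    double = begin
      a ^ suc d + a ^ suc d ≡⟨ cong (a ^ suc d +_) (+-identityʳ _) ⟨
      2 * a ^ suc d         ≤⟨ *-monoˡ-≤ (a ^ suc d) (≤-trans (s≤s (s≤s z≤n)) 4+j≤a) ⟩
      a * a ^ suc d         ∎

-- Induction on `t`: the root grows by at most one when `t` does.
integerRoot : ∀ d t → ∃ λ a → a ^ suc d ≤ t × t < suc a ^ suc d
integerRoot d zero = 0 , z≤n , m^n>0 1 (suc d)
integerRoot d (suc t) with a , a^≤ , t< ← integerRoot d t | suc a ^ suc d ≤? suc t
... | yes ≤t = suc a , ≤t , ≤-<-trans t< (^-monoˡ-< (suc d) (n<1+n (suc a)))
... | no  ≰t = a , m≤n⇒m≤1+n a^≤ , ≰⇒> ≰t

rootBound⇒≤ : ∀ {b r} s C → 0 < C → b ^ ℤ.∣ ↥ s ∣ ≤ C ^ ↧ₙ s → RootBound b s r → r ℚ.≤ fromℤ (ℤ.+ C)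
rootBound⇒≤ {b} {r} s C 0<C b^≤ r^≤ with r ℚ.≤? fromℤ (ℤ.+ C)
... | yes r≤C = r≤C
... | no  r≰C = contradiction
  (ℚ.<-≤-trans (^ℚ-mono-< {{fromℤ-pos 0<C}} (ℚ.≰⇒> r≰C) (ℚ.denominator-1 s)) (ℚ.≤-trans r^≤
    (subst (fromℤ (ℤ.+ (b ^ ℤ.∣ ↥ s ∣)) ℚ.≤_) (sym (fromℤ-^ C (↧ₙ s))) (fromℤ-mono b^≤))))
  (ℚ.<-irrefl refl)

∣↥∣≤ : ∀ s {a} → 0ℚ ℚ.≤ s → s ℚ.≤ fromℤ (ℤ.+ a) → ℤ.∣ ↥ s ∣ ≤ a * ↧ₙ s
∣↥∣≤ (mkℚ (ℤ.+ u) v-1 _) {a} _ (ℚ.*≤* s≤a) =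
  ℤ.drop‿+≤+ (subst₂ ℤ._≤_ (ℤ.*-identityʳ _) (sym (ℤ.pos-* a (suc v-1))) s≤a)
∣↥∣≤ (mkℚ ℤ.-[1+ _ ] _ _) (ℚ.*≤* ()) _

-- For `s = u/v` in `x`, the bound `s ≤ a` gives `u ≤ a * v`, so `2 ^ u ≤ (2 ^ a) ^ v`, and the
-- `v`-th root can be taken.
2^ᴿ-≤ᴺ : ∀ {x a} → x ≤ᴺ a → 2 ^ᴿ x ≤ᴺ 2 ^ a
2^ᴿ-≤ᴺ {x} {a} x≤a r (_ , s , x∋s , r^≤) = rootBound⇒≤ {2} s (2 ^ a) (m^n>0 2 a)
  (≤-trans (^-monoʳ-≤ 2 (∣↥∣≤ s (ℝ≥0.nonneg x x∋s) (x≤a s x∋s)))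
    (≤-reflexive (sym (^-*-assoc 2 a (↧ₙ s))))) r^≤

T-≤ᴺ : ∀ i {x a} → x ≤ᴺ a → T (suc i) x ≤ᴺ tower i a
T-≤ᴺ zero            x≤a = x≤a
T-≤ᴺ (suc i) {x} {a} x≤a = 2^ᴿ-≤ᴺ {T (suc i) x} (T-≤ᴺ i x≤a)

reciprocal : ℕ → ℝ≥0
reciprocal d-1 = record
  { _∋_       = _≡ 1/d
  ; nonneg    = λ where refl → ℚ.*≤* (ℤ.+≤+ z≤n)
  ; inhabited = 1/d , refl
  ; bounded   = 1 , λ where refl → ℚ.*≤* (ℤ.+≤+ (s≤s z≤n))
  }
  where
  1/d : ℚ
  1/d = mkℚ (ℤ.+ 1) d-1 (1-coprimeTo (suc d-1))

reciprocal-positive : ∀ d-1 → Positive (reciprocal d-1)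
reciprocal-positive d-1 = _ , refl , ℚ.*<* (ℤ.+<+ (s≤s z≤n))

^ᴿ-reciprocal-≤ᴺ : ∀ {t a} d-1 → 0 < a → t ≤ a ^ suc d-1 → t ^ᴿ reciprocal d-1 ≤ᴺ a
^ᴿ-reciprocal-≤ᴺ {t} {a} d-1 0<a t≤ r (_ , s , refl , r^≤) =
  rootBound⇒≤ {t} s a 0<a (subst (_≤ a ^ suc d-1) (sym (*-identityʳ t)) t≤) r^≤

corollary1p5 : ∀ (k : ℕ) → k ≥ 4 →
    ∃ λ (c : ℝ≥0) → Positive c ×
    (∃ λ (t₀ : ℕ) → ∀ (t : ℕ) → t ≥ t₀ →
    ∀ (r : ℕ) → IsRamseyNumber k t 3 3 r → T (k ∸ 1) (t ^ᴿ c) ≤ᴺ r)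
corollary1p5 (suc (suc (suc j))) (s≤s (s≤s (s≤s _))) with d , rainbow ← rainbow-tower j =
  -- The exponent is `c = 1 / (2 * suc d)`; the argument is the predecessor of the unfolded
  -- `2 * suc d`. The threshold forces the integer root `a` of `t` to be at least `3 + j`.
  reciprocal (d + (suc d + 0)) , reciprocal-positive (d + (suc d + 0)) , (3 + j) ^ suc d , bound d rainbow
  where
  bound : ∀ d → (∀ a → 3 + j ≤ a → Rainbow (tower (suc j) a) (3 + j) (a ^ suc d)) →
    ∀ t → t ≥ (3 + j) ^ suc d → ∀ r → IsRamseyNumber (3 + j) t 3 3 r →
    T (2 + j) (t ^ᴿ reciprocal (d + (suc d + 0))) ≤ᴺ r
  bound d rainbow t t≥ r (forces , _) x T∋x with a , a^≤ , t< ← integerRoot d t =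
    ℚ.≤-trans (T-≤ᴺ (suc j) (^ᴿ-reciprocal-≤ᴺ (d + (suc d + 0)) (≤-trans (s≤s z≤n) 3+j≤a) t≤) x T∋x)
      -- If `r` were below the tower, the colouring restricted to `r` vertices would show all three
      -- colours in every set of `t ≥ a ^ suc d` vertices.
      (fromℤ-mono (≮⇒≥ λ r<tower → rainbow⇒¬forces
        (rainbow-antitone (≤⇒≤′ (<⇒≤ r<tower)) (rainbow-monotone a^≤ (rainbow a 3+j≤a))) forces))
    where
    open ≤-Reasoning
    3+j≤a : 3 + j ≤ a
    3+j≤a = ≮⇒≥ λ a<3+j → <⇒≱ t< (≤-trans (^-monoˡ-≤ (suc d) a<3+j) t≥)
    -- The factor 2 in the exponent absorbs the rounding of the root, since `suc a ≤ a ^ 2`.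
    t≤ : t ≤ a ^ (2 * suc d)
    t≤ = begin
      t               ≤⟨ <⇒≤ t< ⟩
      suc a ^ suc d   ≤⟨ ^-monoˡ-≤ (suc d) (begin
        suc a           ≤⟨ +-monoˡ-≤ a (≤-trans (s≤s z≤n) 3+j≤a) ⟩
        a + a           ≡⟨ cong (a +_) (+-identityʳ a) ⟨
        2 * a           ≤⟨ *-monoˡ-≤ a (≤-trans (s≤s (s≤s z≤n)) 3+j≤a) ⟩
        a * a           ≡⟨ cong (a *_) (*-identityʳ a) ⟨
        a ^ 2           ∎) ⟩
      (a ^ 2) ^ suc d ≡⟨ ^-*-assoc a 2 (suc d) ⟩
      a ^ (2 * suc d) ∎
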